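{- There is a constant $c>0$ such that for every $k\ge2$ and every $n\ge3$, Duplicator has a strategy in the bijective $k$-walk pebble game played on $X(G^2_n)$ and $\tilde X(G^2_n)$ such that Spoiler does not win within the first $c\,n$ rounds (i.e., Spoiler wins in $\Omega(n)$ rounds at the earliest).
   Context: $G^2_n$ is the $2\times n$ grid graph (vertices $(i,j)$, $i\in\{1,2\}$, $j\in[n]$, adjacent iff they differ by one in exactly one coordinate) with one additional vertex of degree $1$ attached to one corner. CFI-type construction for a connected simple base graph $G$: fix for each base vertex $v$ an ordering of its incident edges. Replace each base vertex $v$ of degree $d$ by the gadget $F(v)=\{v(a_1,\dots,a_d): (a_1,\dots,a_d)\in\{0,1\}^d \text{ with an even number of ones}\}$, an independent set. For each base edge $\{u,v\}$ that is the $i$-th edge at $u$ (degree $d$) and the $j$-th edge at $v$ (degree $d'$), add all edges $\{u(a_1,\dots,a_d),v(b_1,\dots,b_{d'})\}$ with $a_i=b_j$. The result is the undirected graph $X(G)$. $\tilde X(G)$ is obtained from $X(G)$ by twisting one base edge $\{u,v\}$, i.e. replacing adjacency by non-adjacency and vice versa for all pairs between $F(u)$ and $F(v)$; up to isomorphism this does not depend on the chosen edge. Bijective $k$-walk pebble game on $G_1=(V_1,E_1)$, $G_2=(V_2,E_2)$: pebble pairs $(p_i,q_i)$, $i\in[k+1]$; pairs $i,i+1$ ($i\in[k]$) and $k+1,1$ are consecutive. If $|V_1|\ne|V_2|$ Spoiler wins immediately; otherwise pebbles start beside the graphs. Each round: (1) if pebbles are on the graphs, Spoiler chooses a pair $(p_i,q_i)$,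 relabels it $(p_1,q_1)$ and relabels the next consecutive pair, if placed, $(p_{k+1},q_{k+1})$, then removes all other pairs; (2) Duplicator chooses a bijection $f\colon V_1^{k-1}\to V_2^{k-1}$; (3) Spoiler chooses $(u_2,\dots,u_k)\in V_1^{k-1}$, places $p_i$ on $u_i$ and $q_i$ on $v_i$ where $f(u_2,\dots,u_k)=(v_2,\dots,v_k)$. Spoiler wins after a round if some consecutive pebble pairs lie on $(a,b)\in V_1^2$ and $(a',b')\in V_2^2$ such that $a\mapsto a',b\mapsto b'$ is not an isomorphism between the subgraphs induced on $\{a,b\}$ and $\{a',b'\}$. -}

module Defs where

open import Data.Nat using (ℕ; zero; suc; _<?_; _∸_; _%_)
open import Data.Bool using (Bool; true; false; _xor_)
open import Data.Fin using (Fin; zero; suc; toℕ; fromℕ<)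
open import Data.List using (List; []; _∷_; [_]; _++_; length)
import Data.List as List
open import Data.Vec using (Vec; lookup)
open import Data.Maybe using (Maybe; just; nothing; maybe; Is-just)
open import Data.Product using (Σ; _×_; _,_)
open import Data.Unit using (⊤)
open import Function.Bundles using (_⤖_; _⇔_; Bijection)
open import Relation.Binary.PropositionalEquality using (_≡_)
open import Relation.Nullary using (yes; no)

-- Generic CFI construction.
-- A connected simple base graph is given by its vertex type V and, for
-- every vertex v, the ORDERED list nbrs v of its neighbours; the i-th
-- entry is the other endpoint of the i-th incident edge of v
-- (the graph is simple, so incident edges <-> neighbours), and
-- deg v = length (nbrs v).

ones : ∀ {d} → Vec Bool d → ℕ
ones Vec.[] = 0
ones (true Vec.∷ a) = suc (ones a)
ones (false Vec.∷ a) = ones a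

CFIVertex : (V : Set) → (V → List V) → Set
CFIVertex V nbrs =
  Σ V λ v → Σ (Vec Bool (length (nbrs v))) λ a → ones a % 2 ≡ 0

-- adjacency in the CFI graph, where tw u v = true marks twisted base
-- edges.  For the base edge {u,v} which is the i-th edge at u and the
-- j-th edge at v, u(a) ~ v(b) iff a_i = b_j (untwisted) resp.
-- a_i ≠ b_j (twisted), i.e. iff (a_i xor b_j) = tw u v.
CFIAdj : (V : Set) (nbrs : V → List V) (tw : V → V → Bool) →
         CFIVertex V nbrs → CFIVertex V nbrs → Set
CFIAdj V nbrs tw (u , a , _) (v , b , _) =
  Σ (Fin (length (nbrs u))) λ i → Σ (Fin (length (nbrs v))) λ j →
    (List.lookup (nbrs u) i ≡ v) × (List.lookup (nbrs v) j ≡ u) ×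
    ((lookup a i xor lookup b j) ≡ tw u v)

-- The base graph G^2_n : the 2 x n grid (rows Fin 2, columns Fin n)
-- plus a pendant vertex attached to the corner (row 0, column 0).

data GVert (n : ℕ) : Set where
  cell : Fin 2 → Fin n → GVert n
  pend : GVert n

otherRow : Fin 2 → Fin 2
otherRow zero = suc zero
otherRow (suc _) = zero

prevCol : ∀ {n} → Fin n → Maybe (Fin n)
prevCol zero = nothing
prevCol (suc j) = just (Data.Fin.inject₁ j)

nextCol : ∀ {n} → Fin n → Maybe (Fin n)
nextCol {n} j with suc (toℕ j) <? n
... | yes p = just (fromℕ< p)
... | no _ = nothing

toList : ∀ {A : Set} → Maybe A → List A
toList = maybe [_] []

pendL : ∀ {n} → Fin 2 → Fin n → List (GVert n)
pendL zero zero = [ pend ]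
pendL _ _ = []

gridNbrs : ∀ {n} → GVert n → List (GVert n)
gridNbrs (cell i j) =
  cell (otherRow i) j ∷
  (toList (Data.Maybe.map (cell i) (prevCol j)) ++
   toList (Data.Maybe.map (cell i) (nextCol j)) ++
   pendL i j)
gridNbrs {zero} pend = []
gridNbrs {suc n} pend = [ cell zero zero ]

gridTwist : ∀ {n} → GVert n → GVert n → Bool
gridTwist pend (cell zero zero) = true
gridTwist (cell zero zero) pend = true
gridTwist _ _ = false

noTwist : ∀ {n} → GVert n → GVert n → Bool
noTwist _ _ = false

XV : ℕ → Set
XV n = CFIVertex (GVert n) gridNbrs

XE : ∀ n → XV n → XV n → Set
XE n = CFIAdj (GVert n) gridNbrs noTwist

X~E : ∀ n → XV n → XV n → Set
X~E n = CFIAdj (GVert n) gridNbrs gridTwist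

-- Bijective k-walk pebble game, with k = m + 2 (k ≥ 2).
-- Pebble pairs 1 .. k+1:  one = pair 1,  mid j = pair j+2
-- (j : Fin (suc m), i.e. pairs 2..k),  top = pair k+1.

data Peb (m : ℕ) : Set where
  one : Peb m
  mid : Fin (suc m) → Peb m
  top : Peb m

next : ∀ {m} → Peb m → Peb m
next one = mid zero
next {m} (mid j) with suc (toℕ j) <? suc m
... | yes p = mid (fromℕ< p)
... | no _ = top
next top = one

module Game {V₁ V₂ : Set} (E₁ : V₁ → V₁ → Set) (E₂ : V₂ → V₂ → Set)
            (m : ℕ) where

  -- a position: for each pair, either beside the graphs or on (p_i, q_i)
  Pos : Set
  Pos = Peb m → Maybe (V₁ × V₂)

  initial : Pos
  initial _ = nothing

  Empty : Pos → Set
  Empty P = ∀ x → P x ≡ nothing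

  PartialIso : V₁ → V₁ → V₂ → V₂ → Set
  PartialIso a b a′ b′ = ((a ≡ b) ⇔ (a′ ≡ b′)) × (E₁ a b ⇔ E₂ a′ b′)

  Good : Pos → Set
  Good P = ∀ x {a b : V₁} {a′ b′ : V₂} →
           P x ≡ just (a , a′) → P (next x) ≡ just (b , b′) →
           PartialIso a b a′ b′

  reset : Pos → Peb m → Pos
  reset P i one = P i
  reset P i (mid _) = nothing
  reset P i top = P (next i)

  place : Pos → Vec V₁ (suc m) → Vec V₂ (suc m) → Pos
  place Q u v one = Q one
  place Q u v (mid j) = just (lookup u j , lookup v j)
  place Q u v top = Q top

  mutual
    Survives : ℕ → Pos → Set
    Survives zero P = ⊤
    Survives (suc r) P =
      (Empty P → Respond r P) ×
      (∀ i → Is-just (P i) → Respond r (reset P i))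

    Respond : ℕ → Pos → Set
    Respond r Q =
      Σ (Vec V₁ (suc m) ⤖ Vec V₂ (suc m)) λ f →
        ∀ u → Good (place Q u (Bijection.to f u)) ×
              Survives r (place Q u (Bijection.to f u))

-- Duplicator has a strategy in the bijective k-walk pebble game on
-- (V₁,E₁), (V₂,E₂) such that Spoiler does not win within the first r rounds
-- (intended for k ≥ 2; m = k - 2).
DuplicatorSurvives : ∀ {V₁ V₂ : Set} → (V₁ → V₁ → Set) → (V₂ → V₂ → Set) →
                     (k r : ℕ) → Set
DuplicatorSurvives E₁ E₂ k r =
  Game.Survives E₁ E₂ (k ∸ 2) r (Game.initial E₁ E₂ (k ∸ 2))

{-# OPTIONS --safe #-}
module Submission where

-- A choice of even flips in all gadgets (a gauge) is almost an isomorphism from X(G) to the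
-- twisted graph: it may fail only along one base edge, where the twist is then said to hide.
-- Flipping two coordinates at a vertex p moves the twist from one edge at p to another
-- without affecting any other gadget. Duplicator keeps the twist on a rung of a column j
-- that contains none of the two remaining pebbles. Given Spoiler's base walk, all pebbles
-- outside column j follow the current gauge; only a stretch of the walk inside column j
-- needs care, and there one of its two rows can always follow the current gauge while the
-- other one lets the twist pass to column j - 1 or j + 1. Thus each consecutive pair agrees
-- with a gauge hiding the twist in column j - 1, j or j + 1, away from that pair, no matter
-- how long the walk is. The hiding column moves by at most one per round, so starting in
-- column r with 2r < n suffices for r rounds.

open import Defs
open import Data.Nat using (ℕ; zero; suc; _≤_; _<_; _<?_; _%_; z≤n; s≤s)
import Data.Nat as ℕ
import Data.Nat.Properties as ℕ
open import Data.Nat.DivMod using (%-distribˡ-+)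
open import Data.Integer using (+_)
import Data.Integer as ℤ
import Data.Integer.Properties as ℤ
open import Data.Rational using (ℚ; Positive; _/_; _*_)
import Data.Rational as ℚ
import Data.Rational.Properties as ℚ
import Data.Rational.Unnormalised as ℚᵘ
import Data.Rational.Unnormalised.Properties as ℚᵘ
open import Data.Bool using (Bool; true; false; _xor_; _∧_; if_then_else_)
open import Data.Bool.Properties
  using (xor-assoc; xor-same; xor-identityʳ; ∧-zeroʳ; ∧-distribˡ-xor)
open import Data.Bool.Solver using (module xor-∧-Solver)
open import Data.Fin using (Fin; zero; suc; toℕ; fromℕ<)
import Data.Fin.Properties as Fin
open import Data.Fin.Induction using (<-weakInduction)
open import Data.List using (List; []; _∷_; _++_)
import Data.List as List
open import Data.Vec using (Vec; []; _∷_; lookup; zipWith)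
import Data.Vec as Vec
open import Data.Vec.Properties using (lookup-zipWith; lookup-map; map-cong)
open import Data.Maybe using (Maybe; just; nothing; maybe′)
import Data.Maybe as Maybe
open import Data.Product using (Σ; ∃; _×_; _,_; proj₁; proj₂)
open import Data.Sum using (_⊎_; inj₁; inj₂; swap)
open import Data.Unit using (⊤; tt)
open import Function using (_∘_)
open import Function.Bundles using (_⤖_; _⇔_; mk⇔; mk↔ₛ′)
open import Function.Properties.Inverse using (↔⇒⤖)
open import Relation.Binary using (DecidableEquality)
open import Relation.Binary.PropositionalEquality
  using (_≡_; _≢_; refl; sym; trans; cong; cong₂; subst; subst₂; module ≡-Reasoning)
open import Relation.Nullary using (¬_; yes; no; does; contradiction)
open import Relation.Nullary.Decidable using (dec-true; dec-false)

-- Parity of bit vectors and of sums over lists.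

parity : ∀ {d} → Vec Bool d → Bool
parity = Vec.foldr′ _xor_ false

ones%2 : ∀ {d} (a : Vec Bool d) → ones a % 2 ≡ (if parity a then 1 else 0)
ones%2 []          = refl
ones%2 (false ∷ a) = ones%2 a
ones%2 (true ∷ a)  = trans (%-distribˡ-+ 1 (ones a) 2)
  (trans (cong (λ x → (1 ℕ.+ x) % 2) (ones%2 a)) (flipped (parity a)))
  where
  flipped : ∀ b → (1 ℕ.+ (if b then 1 else 0)) % 2 ≡ (if true xor b then 1 else 0)
  flipped false = refl
  flipped true  = refl

even⇒parity : ∀ {d} (a : Vec Bool d) → ones a % 2 ≡ 0 → parity a ≡ false
even⇒parity a e with parity a | ones%2 a
... | false | _ = refl
... | true  | p = contradiction (trans (sym p) e) (λ ())

parity⇒even : ∀ {d} (a : Vec Bool d) → parity a ≡ false → ones a % 2 ≡ 0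
parity⇒even a p = trans (ones%2 a) (cong (λ b → if b then 1 else 0) p)

xor-interchange : ∀ a b c d → (a xor b) xor (c xor d) ≡ (a xor c) xor (b xor d)
xor-interchange = solve 4 (λ a b c d → (a :+ b) :+ (c :+ d) := (a :+ c) :+ (b :+ d)) refl
  where open xor-∧-Solver

parity-xor : ∀ {d} (a b : Vec Bool d) → parity (zipWith _xor_ a b) ≡ parity a xor parity b
parity-xor []      []      = refl
parity-xor (x ∷ a) (y ∷ b) = trans (cong ((x xor y) xor_) (parity-xor a b))
  (xor-interchange x y (parity a) (parity b))

xor-cancelʳ : ∀ x y → (x xor y) xor y ≡ x
xor-cancelʳ x y = trans (xor-assoc x y y) (trans (cong (x xor_) (xor-same y)) (xor-identityʳ x))

zipWith-xor-cancel : ∀ {d} (a b : Vec Bool d) → zipWith _xor_ (zipWith _xor_ a b) b ≡ a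
zipWith-xor-cancel []      []      = refl
zipWith-xor-cancel (x ∷ a) (y ∷ b) = cong₂ _∷_ (xor-cancelʳ x y) (zipWith-xor-cancel a b)

lookup-fromList : ∀ {A : Set} (l : List A) i → lookup (Vec.fromList l) i ≡ List.lookup l i
lookup-fromList (x ∷ l) zero    = refl
lookup-fromList (x ∷ l) (suc i) = lookup-fromList l i

module _ {V : Set} where

  total : (V → Bool) → List V → Bool
  total f l = parity (Vec.map f (Vec.fromList l))

  total-xor : ∀ f g l → total (λ w → f w xor g w) l ≡ total f l xor total g l
  total-xor f g []      = refl
  total-xor f g (w ∷ l) = trans (cong ((f w xor g w) xor_) (total-xor f g l))
    (xor-interchange (f w) (g w) (total f l) (total g l))

  total-∧ : ∀ b f l → total (λ w → b ∧ f w) l ≡ b ∧ total f l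
  total-∧ b f []      = sym (∧-zeroʳ b)
  total-∧ b f (w ∷ l) = trans (cong ((b ∧ f w) xor_) (total-∧ b f l))
    (sym (∧-distribˡ-xor b (f w) (total f l)))

  total-++ : ∀ f l l′ → total f (l ++ l′) ≡ total f l xor total f l′
  total-++ f []      l′ = refl
  total-++ f (w ∷ l) l′ = trans (cong (f w xor_) (total-++ f l l′))
    (sym (xor-assoc (f w) (total f l) (total f l′)))

-- Gauges of a CFI graph and how a defect moves.

module CFI {V : Set} (_≟_ : DecidableEquality V) (nbrs : V → List V) where

  -- flip v w tells whether the w-coordinate of the gadget at v is complemented.
  record Gauge : Set where
    field
      flip : V → V → Bool
      even : ∀ v → total (flip v) (nbrs v) ≡ false
  open Gauge public

  infix 4 _≈[_]_
  _≈[_]_ : Gauge → V → Gauge → Set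
  g ≈[ v ] h = ∀ w → flip g v w ≡ flip h v w

  offset : Gauge → ∀ v → Vec Bool (List.length (nbrs v))
  offset g v = Vec.map (flip g v) (Vec.fromList (nbrs v))

  CFIVertex-≡ : ∀ {v a b} {e : ones a % 2 ≡ 0} {e′ : ones b % 2 ≡ 0} → a ≡ b →
                _≡_ {A = CFIVertex V nbrs} (v , a , e) (v , b , e′)
  CFIVertex-≡ {v} {a} refl = cong (λ e → v , a , e) (ℕ.≡-irrelevant _ _)

  act : Gauge → CFIVertex V nbrs → CFIVertex V nbrs
  act g (v , a , e) = v , zipWith _xor_ a (offset g v) ,
    parity⇒even (zipWith _xor_ a (offset g v))
      (trans (parity-xor a (offset g v)) (cong₂ _xor_ (even⇒parity a e) (even g v)))

  act-involutive : ∀ g x → act g (act g x) ≡ x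
  act-involutive g (v , a , e) = CFIVertex-≡ (zipWith-xor-cancel a (offset g v))

  act-cong : ∀ g h x → g ≈[ proj₁ x ] h → act g x ≡ act h x
  act-cong g h (v , a , e) eq =
    CFIVertex-≡ (cong (zipWith _xor_ a) (map-cong eq (Vec.fromList (nbrs v))))

  act-injective : ∀ g {x y} → act g x ≡ act g y → x ≡ y
  act-injective g {x} {y} eq =
    trans (sym (act-involutive g x)) (trans (cong (act g) eq) (act-involutive g y))

  lookup-act : ∀ g v (a : Vec Bool (List.length (nbrs v))) i {w} → List.lookup (nbrs v) i ≡ w →
    lookup (zipWith _xor_ a (offset g v)) i ≡ lookup a i xor flip g v w
  lookup-act g v a i refl = trans (lookup-zipWith _xor_ i a (offset g v))
    (cong (lookup a i xor_) (trans (lookup-map i (flip g v) (Vec.fromList (nbrs v)))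
      (cong (flip g v) (lookup-fromList (nbrs v) i))))

  -- The flips at the two ends of a base edge add `flip g v w xor flip g w v` to the sum that
  -- decides adjacency. The hypothesis is local to `v` and `w`, so a gauge with a defect elsewhere
  -- still qualifies.
  act-adj : ∀ g {tw tw′ : V → V → Bool} x y →
    (let v = proj₁ x; w = proj₁ y) →
    tw v w xor (flip g v w xor flip g w v) ≡ tw′ v w →
    CFIAdj V nbrs tw x y → CFIAdj V nbrs tw′ (act g x) (act g y)
  act-adj g {tw} {tw′} (v , a , _) (w , b , _) eq (i , j , p , q , r) =
    i , j , p , q , (begin
      lookup (zipWith _xor_ a (offset g v)) i xor lookup (zipWith _xor_ b (offset g w)) j
        ≡⟨ cong₂ _xor_ (lookup-act g v a i p) (lookup-act g w b j q) ⟩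
      (lookup a i xor flip g v w) xor (lookup b j xor flip g w v)
        ≡⟨ xor-interchange (lookup a i) (flip g v w) (lookup b j) (flip g w v) ⟩
      (lookup a i xor lookup b j) xor (flip g v w xor flip g w v)
        ≡⟨ cong (_xor (flip g v w xor flip g w v)) r ⟩
      tw v w xor (flip g v w xor flip g w v)
        ≡⟨ eq ⟩
      tw′ v w ∎)
    where open ≡-Reasoning

  -- The converse is `act-adj` with `tw` and `tw′` exchanged, since `act g` is an involution.
  act-adj⇔ : ∀ g {tw tw′ : V → V → Bool} x y →
    (let v = proj₁ x; w = proj₁ y) →
    tw v w xor (flip g v w xor flip g w v) ≡ tw′ v w →
    CFIAdj V nbrs tw x y ⇔ CFIAdj V nbrs tw′ (act g x) (act g y)
  act-adj⇔ g {tw} {tw′} x@(v , _) y@(w , _) eq = mk⇔ (act-adj g {tw} {tw′} x y eq)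
    (λ A → subst₂ (CFIAdj V nbrs tw) (act-involutive g x) (act-involutive g y)
      (act-adj g {tw′} {tw} (act g x) (act g y) back A))
    where
    s = flip g v w xor flip g w v
    back : tw′ v w xor s ≡ tw v w
    back = trans (cong (_xor s) (sym eq)) (xor-cancelʳ (tw v w) s)

  is : V → V → Bool
  is u v = does (u ≟ v)

  is-refl : ∀ u → is u u ≡ true
  is-refl u = dec-true (u ≟ u) refl

  is-≢ : ∀ {u v} → u ≢ v → is u v ≡ false
  is-≢ {u} {v} = dec-false (u ≟ v)

  -- For `x ≢ y`, the indicator of the unordered base edge between `x` and `y`.
  edge : V → V → V → V → Bool
  edge x y v w = (is x v ∧ is y w) xor (is y v ∧ is x w)

  edge-sym : ∀ x y v w → edge x y v w ≡ edge y x v w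
  edge-sym x y v w =
    solve 2 (λ s t → s :+ t := t :+ s) refl (is x v ∧ is y w) (is y v ∧ is x w)
    where open xor-∧-Solver

  edge-off : ∀ {x y v} w → x ≢ v → y ≢ v → edge x y v w ≡ false
  edge-off w x≢v y≢v rewrite is-≢ x≢v | is-≢ y≢v = refl

  turn : V → V → V → V → V → Bool
  turn p x y v w = is p v ∧ (is x w xor is y w)

  turn-off : ∀ {p x y v} w → p ≢ v → turn p x y v w ≡ false
  turn-off w p≢v rewrite is-≢ p≢v = refl

  -- Occurrences are counted modulo 2, so that adjacency enters the evenness condition of a gauge
  -- linearly, with no positions in `nbrs` to track.
  Nbr : V → V → Set
  Nbr v w = total (is w) (nbrs v) ≡ true

  turn-even : ∀ p x y → Nbr p x → Nbr p y → ∀ v → total (turn p x y v) (nbrs v) ≡ false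
  turn-even p x y nx ny v with p ≟ v
  ... | no _     = total-∧ false (λ w → is x w xor is y w) (nbrs v)
  ... | yes refl = trans (total-xor (is x) (is y) (nbrs p)) (cong₂ _xor_ nx ny)

  ε : Gauge
  ε = record { flip = λ _ _ → false ; even = λ v → total-∧ false (λ _ → false) (nbrs v) }

  turned : Gauge → ∀ p x y → Nbr p x → Nbr p y → Gauge
  turned g p x y nx ny = record
    { flip = λ v w → flip g v w xor turn p x y v w
    ; even = λ v → trans (total-xor (flip g v) (turn p x y v) (nbrs v))
                     (cong₂ _xor_ (even g v) (turn-even p x y nx ny v))
    }

  turned-off : ∀ g p x y (nx : Nbr p x) (ny : Nbr p y) {v} → p ≢ v →
    turned g p x y nx ny ≈[ v ] g
  turned-off g p x y nx ny {v} p≢v w = trans (cong (flip g v w xor_) (turn-off w p≢v)) (xor-identityʳ _)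

  -- g maps the untwisted CFI graph onto the one twisted along tw, except that
  -- adjacency is complemented along the single base edge x y.
  record Defect (tw : V → V → Bool) (g : Gauge) (x y : V) : Set where
    constructor defect
    field mismatch : ∀ v w → flip g v w xor flip g w v ≡ tw v w xor edge x y v w
  open Defect public

  defect-sym : ∀ {tw} g {x y} → Defect tw g x y → Defect tw g y x
  defect-sym {tw} g {x} {y} d = defect λ v w → trans (mismatch d v w) (cong (tw v w xor_) (edge-sym x y v w))

  -- Summed over both directions, the turn contributes `edge p x` plus `edge p y`; the first cancels
  -- the old defect and the second is the new one.
  turned-defect : ∀ {tw} g {p x y} (nx : Nbr p x) (ny : Nbr p y) →
    Defect tw g p x → Defect tw (turned g p x y nx ny) p y
  turned-defect {tw} g {p} {x} {y} nx ny d = defect λ v w →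
    let a = flip g v w; b = flip g w v in begin
      (a xor turn p x y v w) xor (b xor turn p x y w v)
        ≡⟨ solve 8 (λ a b P X Y P′ X′ Y′ →
              (a :+ P :* (X′ :+ Y′)) :+ (b :+ P′ :* (X :+ Y)) :=
              (a :+ b) :+ ((P :* X′ :+ X :* P′) :+ (P :* Y′ :+ Y :* P′)))
            refl a b (is p v) (is x v) (is y v) (is p w) (is x w) (is y w) ⟩
      (a xor b) xor (edge p x v w xor edge p y v w)
        ≡⟨ cong (_xor (edge p x v w xor edge p y v w)) (mismatch d v w) ⟩
      (tw v w xor edge p x v w) xor (edge p x v w xor edge p y v w)
        ≡⟨ solve 3 (λ t e f → (t :+ e) :+ (e :+ f) := t :+ f) refl
            (tw v w) (edge p x v w) (edge p y v w) ⟩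
      tw v w xor edge p y v w ∎
    where
    open ≡-Reasoning
    open xor-∧-Solver

-- Columns of the grid and passing the twist between them.

Beside : ∀ {n} → Fin n → Fin n → Set
Beside j j′ = suc (toℕ j) ≡ toℕ j′ ⊎ suc (toℕ j′) ≡ toℕ j

beside-≢ : ∀ {n} {j j′ : Fin n} → Beside j j′ → j ≢ j′
beside-≢ (inj₁ e) refl = ℕ.1+n≢n e
beside-≢ (inj₂ e) refl = ℕ.1+n≢n e

prevCol-sound : ∀ {n} (j : Fin n) {k} → prevCol j ≡ just k → suc (toℕ k) ≡ toℕ j
prevCol-sound (suc j) refl = cong suc (Fin.toℕ-inject₁ j)

prevCol-complete : ∀ {n} (j : Fin n) {k} → suc (toℕ k) ≡ toℕ j → prevCol j ≡ just k
prevCol-complete (suc j) e =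
  cong just (Fin.toℕ-injective (trans (Fin.toℕ-inject₁ j) (sym (ℕ.suc-injective e))))

nextCol-sound : ∀ {n} (j : Fin n) {k} → nextCol j ≡ just k → suc (toℕ j) ≡ toℕ k
nextCol-sound {n} j eq with suc (toℕ j) <? n
nextCol-sound {n} j refl | yes p = sym (Fin.toℕ-fromℕ< p)

nextCol-complete : ∀ {n} (j : Fin n) {k} → suc (toℕ j) ≡ toℕ k → nextCol j ≡ just k
nextCol-complete {n} j {k} e with suc (toℕ j) <? n
... | yes p = cong just (Fin.toℕ-injective (trans (Fin.toℕ-fromℕ< p) e))
... | no ¬p = contradiction (subst (_< n) (sym e) (Fin.toℕ<n k)) ¬p

otherRow-≢ : ∀ i → i ≢ otherRow i
otherRow-≢ zero       ()
otherRow-≢ (suc zero) ()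

cell-injective : ∀ {n} {i i′} {j j′ : Fin n} → cell i j ≡ cell i′ j′ → i ≡ i′ × j ≡ j′
cell-injective refl = refl , refl

_≟ᵍ_ : ∀ {n} → DecidableEquality (GVert n)
cell i j ≟ᵍ cell i′ j′ with i Fin.≟ i′ | j Fin.≟ j′
... | yes refl | yes refl = yes refl
... | no i≢    | _        = no (i≢ ∘ proj₁ ∘ cell-injective)
... | yes _    | no j≢    = no (j≢ ∘ proj₂ ∘ cell-injective)
cell _ _ ≟ᵍ pend     = no λ ()
pend     ≟ᵍ cell _ _ = no λ ()
pend     ≟ᵍ pend     = yes refl

module Grid (n : ℕ) where

  open CFI (_≟ᵍ_ {n}) gridNbrs public

  inRow : Fin 2 → Maybe (Fin n) → List (GVert n)
  inRow i c = toList (Maybe.map (cell i) c)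

  inRow-∉ : ∀ u i c → (∀ {k} → c ≡ just k → u ≢ cell i k) → total (is u) (inRow i c) ≡ false
  inRow-∉ u i (just k) u≢ = cong (_xor false) (is-≢ (u≢ refl))
  inRow-∉ u i nothing  u≢ = refl

  inRow-∈ : ∀ i {c k} → c ≡ just k → total (is (cell i k)) (inRow i c) ≡ true
  inRow-∈ i {k = k} refl = cong (_xor false) (is-refl (cell i k))

  pendL-∉ : ∀ {i′ j′} i (j : Fin n) → total (is (cell i′ j′)) (pendL i j) ≡ false
  pendL-∉ zero    zero    = refl
  pendL-∉ zero    (suc j) = refl
  pendL-∉ (suc i) zero    = refl
  pendL-∉ (suc i) (suc j) = refl

  total-gridNbrs : ∀ f i j → total f (gridNbrs (cell i j)) ≡
    f (cell (otherRow i) j) xor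
    (total f (inRow i (prevCol j)) xor (total f (inRow i (nextCol j)) xor total f (pendL i j)))
  total-gridNbrs f i j = cong (f (cell (otherRow i) j) xor_)
    (trans (total-++ f (inRow i (prevCol j)) _)
      (cong (total f (inRow i (prevCol j)) xor_) (total-++ f (inRow i (nextCol j)) (pendL i j))))

  rung-nbr : ∀ i j → Nbr (cell i j) (cell (otherRow i) j)
  rung-nbr i j = trans (total-gridNbrs (is u) i j)
    (cong₂ _xor_ (is-refl u) (cong₂ _xor_ (inRow-∉ u i (prevCol j) (λ _ → other))
      (cong₂ _xor_ (inRow-∉ u i (nextCol j) (λ _ → other)) (pendL-∉ i j))))
    where
    u = cell (otherRow i) j
    other : ∀ {k} → u ≢ cell i k
    other eq = otherRow-≢ i (sym (proj₁ (cell-injective eq)))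

  side-nbr : ∀ i {j j′} → Beside j j′ → Nbr (cell i j) (cell i j′)
  side-nbr i {j} {j′} β = trans (total-gridNbrs (is u) i j)
    (cong₂ _xor_ (is-≢ λ eq → otherRow-≢ i (proj₁ (cell-injective eq)))
      (trans (sym (xor-assoc (total (is u) (inRow i (prevCol j))) _ _))
        (cong₂ _xor_ (sides β) (pendL-∉ i j))))
    where
    u = cell i j′
    sides : Beside j j′ →
      total (is u) (inRow i (prevCol j)) xor total (is u) (inRow i (nextCol j)) ≡ true
    sides (inj₁ e) = cong₂ _xor_
      -- Were `j′` also the column before `j`, `toℕ j` would exceed itself by 2.
      (inRow-∉ u i (prevCol j) λ p eq → ℕ.m≢1+n+m (toℕ j) {1} (trans (sym (prevCol-sound j p))
        (cong suc (trans (cong toℕ (sym (proj₂ (cell-injective eq)))) (sym e)))))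
      (inRow-∈ i (nextCol-complete j e))
    sides (inj₂ e) = cong₂ _xor_
      (inRow-∈ i (prevCol-complete j e))
      (inRow-∉ u i (nextCol j) λ p eq → ℕ.m≢1+n+m (toℕ j′) {1} (trans
        (cong toℕ (proj₂ (cell-injective eq))) (trans (sym (nextCol-sound j p)) (cong suc (sym e)))))

  RungDefect : Gauge → Fin n → Set
  RungDefect g j = ∀ i → Defect gridTwist g (cell i j) (cell (otherRow i) j)

  rungDefect : ∀ g i {j} → Defect gridTwist g (cell i j) (cell (otherRow i) j) → RungDefect g j
  rungDefect g zero       d zero       = d
  rungDefect g zero       d (suc zero) = defect-sym g d
  rungDefect g (suc zero) d zero       = defect-sym g d
  rungDefect g (suc zero) d (suc zero) = d

  module _ (g : Gauge) (i : Fin 2) {j j′ : Fin n} (β : Beside j j′) where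

    private
      half : Gauge
      half = turned g (cell i j) (cell (otherRow i) j) (cell i j′) (rung-nbr i j) (side-nbr i β)

    -- The defect travels from the rung of column j to that of column j′ along row i.
    shift : Gauge
    shift = turned half (cell i j′) (cell i j) (cell (otherRow i) j′)
      (side-nbr i (swap β)) (rung-nbr i j′)

    shift-defect : RungDefect g j → RungDefect shift j′
    shift-defect d = rungDefect shift i (turned-defect half _ _
      (defect-sym half (turned-defect g (rung-nbr i j) (side-nbr i β) (d i))))

    -- Both turns take place in row `i`; in particular the cells of the other row keep their flips.
    shift-off : ∀ {v} → cell i j ≢ v → cell i j′ ≢ v → shift ≈[ v ] g
    shift-off ≢v ≢v′ w = trans
      (turned-off half (cell i j′) (cell i j) (cell (otherRow i) j′)
        (side-nbr i (swap β)) (rung-nbr i j′) ≢v′ w)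
      (turned-off g (cell i j) (cell (otherRow i) j) (cell i j′)
        (rung-nbr i j) (side-nbr i β) ≢v w)

rootGauge : ∀ {n} (j : Fin (suc n)) →
  Σ (Grid.Gauge (suc n)) λ g → Grid.RungDefect (suc n) g j
-- One turn at the corner brings the twist from the pendant edge to the rung of column 0; each
-- further column takes one shift along row 0.
rootGauge {n} = <-weakInduction _ (root , rungDefect root zero
    (turned-defect ε pend-nbr (rung-nbr zero zero) (defect ε-match)))
  λ j (g , d) → let β = inj₁ (cong suc (Fin.toℕ-inject₁ j)) in
    shift g zero β , shift-defect g zero β d
  where
  open Grid (suc n)
  corner : GVert (suc n)
  corner = cell zero zero
  pend-nbr : Nbr corner pend
  -- `nextCol zero` is blocked on this test; either outcome leaves `pend` listed once.
  pend-nbr with 1 <? suc n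
  ... | yes _ = refl
  ... | no  _ = refl
  root : Gauge
  root = turned ε corner pend (cell (suc zero) zero) pend-nbr (rung-nbr zero zero)
  -- With no flips at all, the defect and the twisted pendant edge coincide and cancel.
  ε-match : ∀ v w → false ≡ gridTwist v w xor edge corner pend v w
  ε-match (cell zero zero)       (cell i j)             = refl
  ε-match (cell zero zero)       pend                   = refl
  ε-match pend                   pend                   = refl
  ε-match pend                   (cell zero zero)       = refl
  ε-match pend                   (cell zero (suc j))    = refl
  ε-match pend                   (cell (suc i) j)       = refl
  ε-match (cell zero (suc j))    (cell i j′)            = refl
  ε-match (cell zero (suc j))    pend                   = refl
  ε-match (cell (suc i) j)       (cell i′ j′)           = refl
  ε-match (cell (suc i) j)       pend                   = refl

-- Hideouts, and lifting a sequence of base vertices to gauges.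

module Strategy (n : ℕ) where

  open Grid n

  Off : Fin n → GVert n → Set
  Off j v = ∀ i → cell i j ≢ v

  column? : ∀ j v → (∃ λ i → v ≡ cell i j) ⊎ Off j v
  column? j pend       = inj₂ λ _ ()
  column? j (cell i k) with k Fin.≟ j
  ... | yes refl = inj₁ (i , refl)
  ... | no  k≢j  = inj₂ λ _ eq → k≢j (sym (proj₂ (cell-injective eq)))

  -- The twist is hidden on the rung of column col, which Spoiler needs more than
  -- r rounds to push to either end of the grid.
  record Hideout (r : ℕ) : Set where
    field
      col    : Fin n
      gauge  : Gauge
      hidden : RungDefect gauge col
      left   : r ≤ toℕ col
      right  : toℕ col ℕ.+ r < n
  open Hideout

  weaken : ∀ {r} → Hideout (suc r) → Hideout r
  weaken {r} H = record
    { col    = col H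
    ; gauge  = gauge H
    ; hidden = hidden H
    ; left   = ℕ.≤-trans (ℕ.n≤1+n r) (left H)
    ; right  = ℕ.≤-<-trans (ℕ.+-monoʳ-≤ (toℕ (col H)) (ℕ.n≤1+n r)) (right H)
    }

  move : ∀ {r} (H : Hideout (suc r)) → Fin 2 → ∀ {j} → Beside (col H) j → Hideout r
  move {r} H i {j} β = record
    { col    = j
    ; gauge  = shift (gauge H) i β
    ; hidden = shift-defect (gauge H) i β (hidden H)
    ; left   = left′ β
    ; right  = right′ β
    }
    where
    left′ : Beside (col H) j → r ≤ toℕ j
    left′ (inj₁ e) = subst (r ≤_) e (ℕ.m≤n⇒m≤1+n (left (weaken H)))
    left′ (inj₂ e) = ℕ.s≤s⁻¹ (subst (suc r ≤_) (sym e) (left H))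
    right′ : Beside (col H) j → toℕ j ℕ.+ r < n
    right′ (inj₁ e) = subst (_< n) (trans (ℕ.+-suc _ r) (cong (ℕ._+ r) e)) (right H)
    right′ (inj₂ e) = ℕ.≤-<-trans
      (ℕ.+-monoˡ-≤ r (subst (toℕ j ≤_) e (ℕ.n≤1+n _))) (right (weaken H))

  -- With a round to spare, there is a column on either side. These two columns are two apart, so
  -- `v` lies in at most one of them; the right one is tried first.
  sidestep : ∀ {r} (H : Hideout (suc r)) v → ∃ λ j → Beside (col H) j × Off j v
  sidestep {r} H v with column? j₁ v
    where
    j₁ = fromℕ< {suc (toℕ (col H))} (ℕ.≤-<-trans
      (subst (_≤ toℕ (col H) ℕ.+ suc r) (ℕ.+-comm _ 1) (ℕ.+-monoʳ-≤ _ (s≤s z≤n))) (right H))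
  ... | inj₂ o          = _ , inj₁ (sym (Fin.toℕ-fromℕ< _)) , o
  ... | inj₁ (i , refl) = j₂ , inj₂ e₂ , λ _ eq → ℕ.m≢1+n+m (toℕ j₂) {1} (trans
      (cong toℕ (proj₂ (cell-injective eq))) (trans (Fin.toℕ-fromℕ< _) (cong suc (sym e₂))))
    where
    instance
      pos : ℕ.NonZero (toℕ (col H))
      pos = ℕ.>-nonZero (ℕ.≤-trans (s≤s z≤n) (left H))
    j₂ : Fin n
    j₂ = fromℕ< (ℕ.≤-<-trans (ℕ.pred[n]≤n {toℕ (col H)}) (Fin.toℕ<n (col H)))
    e₂ : suc (toℕ j₂) ≡ toℕ (col H)
    e₂ = trans (cong suc (Fin.toℕ-fromℕ< _)) (ℕ.suc-pred (toℕ (col H)))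

  -- One hideout explains both vertices. As `g` and `h` are compared with it only at `v` and at `w`,
  -- successive links may use different hideouts.
  record Linked (r : ℕ) (v : GVert n) (g : Gauge) (w : GVert n) (h : Gauge) : Set where
    constructor linked
    field
      hideout : Hideout r
      offˡ    : Off (col hideout) v
      offʳ    : Off (col hideout) w
      agreeˡ  : g ≈[ v ] gauge hideout
      agreeʳ  : h ≈[ w ] gauge hideout

  linked-sym : ∀ {r v g w h} → Linked r v g w h → Linked r w h v g
  linked-sym (linked H o o′ a a′) = linked H o′ o a′ a

  module Walk {r : ℕ} (H : Hideout (suc r)) (end : GVert n) (end-off : Off (col H) end) where

    open Hideout H using () renaming (col to j; gauge to g)

    beside-off : ∀ {i k} → Beside j k → Off k (cell i j)
    beside-off β _ eq = beside-≢ β (sym (proj₂ (cell-injective eq)))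

    stay : ∀ {v w} → Off j v → Off j w → Linked r v g w g
    stay o o′ = linked (weaken H) o o′ (λ _ → refl) (λ _ → refl)

    -- The twist leaves column `j` through the row that `cell i j` does not occupy, toward a side
    -- free of `v`, so neither gadget is touched.
    dodge : ∀ i v → cell (otherRow i) j ≢ v → Linked r v g (cell i j) g
    dodge i v ≢v = let (k , β , o) = sidestep H v in
      linked (move H (otherRow i) β) o (beside-off β)
        (λ w → sym (shift-off g (otherRow i) β ≢v (o (otherRow i)) w))
        (λ w → sym (shift-off g (otherRow i) β
          (λ eq → otherRow-≢ i (sym (proj₁ (cell-injective eq)))) (beside-off β (otherRow i)) w))

    -- Counterpart of `dodge`: the twist passes through `cell i j` itself, which takes the shifted
    -- gauge, while `v` still agrees with `g`.
    enter : ∀ i {k} (β : Beside j k) v → cell i j ≢ v → Off k v →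
      Linked r v g (cell i j) (shift g i β)
    enter i β v ≢v o = linked (move H i β) o (beside-off β)
      (λ w → sym (shift-off g i β ≢v (o i) w)) (λ _ → refl)

    Chain : ∀ {k} → GVert n → Gauge → Vec (GVert n) k → Vec Gauge k → Set
    Chain v h []       []        = Linked r v h end g
    Chain v h (w ∷ ws) (h′ ∷ hs) = Linked r v h w h′ × Chain w h′ ws hs

    -- A vertex outside column `j` always carries `g`. The gauge of a cell where the walk enters the
    -- column is dictated by the rest of the stretch and is left to `lift-inside`.
    lift-outside : ∀ {k} v → Off j v → (ws : Vec (GVert n) k) → ∃ (Chain v g ws)

    -- In a maximal stretch of the walk inside column j, the vertices in the row where the
    -- walk leaves the column keep g; those in the other row let the twist pass through them.
    lift-inside : ∀ {k} i (ws : Vec (GVert n) k) → ∃ (Chain (cell i j) g ws) ⊎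
      (∀ {j′} (β : Beside j j′) → ∃ (Chain (cell i j) (shift g i β) ws))

    lift-outside v o []       = [] , stay o end-off
    lift-outside v o (w ∷ ws) with column? j w
    ... | inj₂ o′ = let (hs , c) = lift-outside w o′ ws in g ∷ hs , stay o o′ , c
    ... | inj₁ (i , refl) with lift-inside i ws
    ...   | inj₁ (hs , c) = g ∷ hs , dodge i v (o _) , c
    -- The side is fixed only here, to avoid the last vertex before the column; hence the second
    -- alternative of `lift-inside` covers every side.
    ...   | inj₂ lifts    = let (_ , β , o′) = sidestep H v; (hs , c) = lifts β in
      shift g i β ∷ hs , enter i β v (o i) o′ , c

    lift-inside i []       = inj₁ ([] , linked-sym (dodge i end (end-off _)))
    lift-inside i (w ∷ ws) with column? j w
    ... | inj₂ o = let (hs , c) = lift-outside w o ws in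
      inj₁ (g ∷ hs , linked-sym (dodge i w (o _)) , c)
    ... | inj₁ (i′ , refl) with i Fin.≟ i′ | lift-inside i′ ws
    ...   | yes refl | inj₁ (hs , c) = inj₁ (g ∷ hs ,
      dodge i (cell i j) (λ eq → otherRow-≢ i (sym (proj₁ (cell-injective eq)))) , c)
    ...   | yes refl | inj₂ lifts    = inj₂ λ β → let (hs , c) = lifts β in shift g i β ∷ hs ,
      linked (move H i β) (beside-off β) (beside-off β) (λ _ → refl) (λ _ → refl) , c
    -- A change of row exchanges the two alternatives.
    ...   | no i≢i′  | inj₁ (hs , c) = inj₂ λ β → g ∷ hs ,
      linked-sym (enter i β (cell i′ j) (i≢i′ ∘ proj₁ ∘ cell-injective) (beside-off β)) , c
    -- Both cells lie in column `j`, so either side will do; `pend` is passed merely to obtain one.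
    ...   | no i≢i′  | inj₂ lifts    = let (_ , β , _) = sidestep H pend; (hs , c) = lifts β in
      inj₁ (shift g i′ β ∷ hs ,
        enter i′ β (cell i j) (i≢i′ ∘ sym ∘ proj₁ ∘ cell-injective) (beside-off β) , c)

  -- Duplicator's replies and the invariant of the game.

  module Play (m : ℕ) where

    open Game (XE n) (X~E n) m

    Sees : ∀ {r} → Hideout r → Maybe (XV n × XV n) → Set
    Sees H nothing        = ⊤
    Sees H (just (x , y)) = Off (col H) (proj₁ x) × y ≡ act (gauge H) x

    Matched : ℕ → Maybe (XV n × XV n) → Maybe (XV n × XV n) → Set
    Matched r p q = Σ (Hideout r) λ H → Sees H p × Sees H q

    -- The hideout may vary with `x`: the winning condition tests consecutive pairs one at a time,
    -- and Spoiler keeps at most one of them.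
    Invariant : ℕ → Pos → Set
    Invariant r P = ∀ x → Matched r (P x) (P (next x))

    -- Away from the hiding column the term `edge` vanishes, so there the gauge respects adjacency
    -- exactly; equality is respected because `act` is injective.
    matched⇒iso : ∀ {r a b a′ b′} → Matched r (just (a , a′)) (just (b , b′)) →
      PartialIso a b a′ b′
    matched⇒iso {_} {a} {b} (H , (o , refl) , (_ , refl)) =
      mk⇔ (cong (act (gauge H))) (act-injective (gauge H)) ,
      act-adj⇔ (gauge H) {tw′ = gridTwist} a b (trans (mismatch (hidden H zero) (proj₁ a) (proj₁ b))
        (trans (cong (gridTwist (proj₁ a) (proj₁ b) xor_) (edge-off (proj₁ b) (o zero) (o (suc zero))))
          (xor-identityʳ _)))

    -- A pair beside the graphs is treated as if it were on the single vertex of F(pend).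
    base : Maybe (XV n × XV n) → GVert n
    base = maybe′ (proj₁ ∘ proj₁) pend

    sees-off : ∀ {r} (H : Hideout r) p → Sees H p → Off (col H) (base p)
    sees-off H (just _) (o , _) = o
    sees-off H nothing  _       = λ _ ()

    sees-agree : ∀ {r s} (H : Hideout r) (R : Hideout s) p → Sees H p →
      Off (col R) (base p) → gauge H ≈[ base p ] gauge R → Sees R p
    sees-agree H R (just (x , _)) (_ , eq) o a = o , trans eq (act-cong (gauge H) (gauge R) x a)
    sees-agree H R nothing        _        _ _ = tt

    module Reply {r : ℕ} (Q : Pos) (H : Hideout (suc r))
                 (seen₁ : Sees H (Q one)) (seen₂ : Sees H (Q top)) where

      open Walk H (base (Q top)) (sees-off H (Q top) seen₂)

      lifted : ∀ {k} (ws : Vec (GVert n) k) → ∃ (Chain (base (Q one)) (gauge H) ws)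
      lifted = lift-outside (base (Q one)) (sees-off H (Q one) seen₁)

      acts : ∀ {k} → Vec Gauge k → Vec (XV n) k → Vec (XV n) k
      acts = zipWith act

      bases : ∀ {k} → Vec (XV n) k → Vec (GVert n) k
      bases = Vec.map proj₁

      bases-acts : ∀ {k} (hs : Vec Gauge k) u → bases (acts hs u) ≡ bases u
      bases-acts []       []      = refl
      bases-acts (h ∷ hs) (x ∷ u) = cong (proj₁ x ∷_) (bases-acts hs u)

      acts-involutive : ∀ {k} (hs : Vec Gauge k) u → acts hs (acts hs u) ≡ u
      acts-involutive []       []      = refl
      acts-involutive (h ∷ hs) (x ∷ u) = cong₂ _∷_ (act-involutive h x) (acts-involutive hs u)

      reply : ∀ {k} → Vec (XV n) k → Vec (XV n) k
      reply u = acts (proj₁ (lifted (bases u))) u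

      -- The gauges depend only on the base vertices, which `act` preserves, so a second application
      -- uses the same gauges and undoes the first. This is what makes the reply a bijection.
      reply-involutive : ∀ {k} (u : Vec (XV n) k) → reply (reply u) ≡ u
      reply-involutive u =
        trans (cong (λ ws → acts (proj₁ (lifted ws)) (reply u)) (bases-acts hs u))
          (acts-involutive hs u)
        where hs = proj₁ (lifted (bases u))

      bijection : Vec (XV n) (suc m) ⤖ Vec (XV n) (suc m)
      bijection = ↔⇒⤖ (mk↔ₛ′ reply reply reply-involutive reply-involutive)

      chain-next : ∀ {k v h} (u : Vec (XV n) k) hs → Chain v h (bases u) hs →
        (i : Fin k) (p : suc (toℕ i) < k) → let i′ = fromℕ< p in
        Linked r (proj₁ (lookup u i)) (lookup hs i) (proj₁ (lookup u i′)) (lookup hs i′)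
      chain-next (x ∷ [])    (h ∷ [])      _           zero    (s≤s ())
      chain-next (x ∷ y ∷ u) (h ∷ h′ ∷ hs) (_ , l , _) zero    p = l
      chain-next (x ∷ u)     (h ∷ hs)      (_ , c)     (suc i) p =
        chain-next u hs c i (ℕ.s≤s⁻¹ p)

      chain-last : ∀ {k v h} (u : Vec (XV n) k) hs → Chain v h (bases u) hs →
        (i : Fin k) → ¬ suc (toℕ i) < k →
        Linked r (proj₁ (lookup u i)) (lookup hs i) (base (Q top)) (gauge H)
      chain-last (x ∷ [])    (h ∷ [])      (_ , l) zero    ¬p = l
      chain-last (x ∷ _ ∷ _) (h ∷ _)       _       zero    ¬p = contradiction (s≤s (s≤s z≤n)) ¬p
      chain-last (x ∷ u)     (h ∷ hs)      (_ , c) (suc i) ¬p = chain-last u hs c i (¬p ∘ s≤s)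

      invariant : ∀ u → Invariant r (place Q u (reply u))
      invariant u = go
        where
        hs = proj₁ (lifted (bases u))
        chain : Chain (base (Q one)) (gauge H) (bases u) hs
        chain = proj₂ (lifted (bases u))
        lookup-reply : ∀ (R : Hideout r) i → lookup hs i ≈[ proj₁ (lookup u i) ] gauge R →
          lookup (reply u) i ≡ act (gauge R) (lookup u i)
        lookup-reply R i a = trans (lookup-zipWith act i hs u) 
            (act-cong (lookup hs i) (gauge R) (lookup u i) a)
        first : ∀ {k v h} (u : Vec (XV n) (suc k)) hs → Chain v h (bases u) hs →
          Linked r v h (proj₁ (lookup u zero)) (lookup hs zero)
        first (x ∷ u) (h ∷ hs) (l , _) = l
        go : Invariant r (place Q u (reply u))
        go one = let linked R o o′ a a′ = first u hs chain in
          R , sees-agree H R (Q one) seen₁ o a , o′ , lookup-reply R zero a′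
        -- The same test as in `next`, so that `next (mid i)` reduces in each branch.
        go (mid i) with suc (toℕ i) <? suc m
        ... | yes p = let linked R o o′ a a′ = chain-next u hs chain i p in
          R , (o , lookup-reply R i a) , o′ , lookup-reply R (fromℕ< p) a′
        ... | no ¬p = let linked R o o′ a a′ = chain-last u hs chain i ¬p in
          R , (o , lookup-reply R i a) , sees-agree H R (Q top) seen₂ o′ a′
        -- The two kept pairs, if placed, are consecutive too and still agree with the old hideout.
        go top = weaken H ,
          sees-agree H (weaken H) (Q top) seen₂ (sees-off H (Q top) seen₂) (λ _ → refl) ,
          sees-agree H (weaken H) (Q one) seen₁ (sees-off H (Q one) seen₁) (λ _ → refl)

    survives : ∀ r P → Invariant r P → Survives r P

    respond : ∀ r Q → Matched (suc r) (Q one) (Q top) → Respond r Q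
    respond r Q (H , seen₁ , seen₂) = bijection , λ u →
      (λ x p q → matched⇒iso (subst₂ (Matched r) p q (invariant u x))) ,
      survives r (place Q u (reply u)) (invariant u)
      where open Reply Q H seen₁ seen₂

    survives zero    P inv = tt
    survives (suc r) P inv =
      -- With nothing placed, the hideout of any consecutive pair serves.
      (λ empty → let H = proj₁ (inv one) in
        respond r P (H , subst (Sees H) (sym (empty one)) tt , subst (Sees H) (sym (empty top)) tt)) ,
      -- `reset` puts pairs `i` and `next i` at `one` and `top`, so `inv i` is the required match.
      λ i _ → respond r (reset P i) (inv i)

-- The starting column and the constant 1/3.

startingHideout : ∀ n r → r ℕ.+ r < n → Strategy.Hideout n r
startingHideout (suc n) r 2r<n = let (g , d) = rootGauge start in record
  { col    = start
  ; gauge  = g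
  ; hidden = d
  ; left   = ℕ.≤-reflexive (sym (Fin.toℕ-fromℕ< _))
  ; right  = subst (λ j → j ℕ.+ r < suc n) (sym (Fin.toℕ-fromℕ< _)) 2r<n
  }
  where
  start : Fin (suc n)
  start = fromℕ< (ℕ.≤-<-trans (ℕ.m≤m+n r r) 2r<n)

-- Over unnormalised rationals the inequality unfolds to its cross-multiplied integer form.
⅓-bound : ∀ r n → (+ r / 1) ℚ.≤ (+ 1 / 3) * (+ n / 1) → r ℕ.* 3 ≤ n
⅓-bound r n r≤n/3 = ℤ.drop‿+≤+ (subst₂ ℤ._≤_
  (sym (ℤ.pos-* r 3))
  (trans (ℤ.*-identityʳ _) (ℤ.*-identityˡ (+ n)))
  (ℚᵘ.drop-*≤* (ℚᵘ.≤-respˡ-≃ (ℚ.toℚᵘ-fromℚᵘ (ℚᵘ.mkℚᵘ (+ r) 0))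
    (ℚᵘ.≤-respʳ-≃ (ℚᵘ.≃-trans (ℚ.toℚᵘ-homo-* (+ 1 / 3) (+ n / 1))
      (ℚᵘ.*-congˡ {ℚ.toℚᵘ (+ 1 / 3)} (ℚ.toℚᵘ-fromℚᵘ (ℚᵘ.mkℚᵘ (+ n) 0))))
      (ℚ.toℚᵘ-mono-≤ r≤n/3)))))

-- For positive `r`, 2r < 3r gives strictness; `r = 0` rests on `3 ≤ n`. The constant 1/2 would
-- admit 2r = n.
double<triple : ∀ r n → 3 ≤ n → r ℕ.* 3 ≤ n → r ℕ.+ r < n
double<triple zero    n 3≤n _    = ℕ.≤-trans (s≤s z≤n) 3≤n
double<triple (suc r) n _   3r≤n = ℕ.<-≤-trans
  (subst (suc r ℕ.+ suc r <_) (ℕ.*-comm 3 (suc r)) below) 3r≤n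
  where
  below : suc r ℕ.+ suc r < 3 ℕ.* suc r
  below = ℕ.+-monoʳ-< (suc r) (ℕ.m<m+n (suc r) (s≤s z≤n))

theorem26 : Σ ℚ λ c → Positive c ×
    (∀ (k n : ℕ) → 2 ≤ k → 3 ≤ n → ∀ (r : ℕ) →
    (+ r / 1) ℚ.≤ c * (+ n / 1) →
    DuplicatorSurvives (XE n) (X~E n) k r)
theorem26 = (+ 1 / 3) , _ , λ k n _ 3≤n r r≤n/3 →
  let H = startingHideout n r (double<triple r n 3≤n (⅓-bound r n r≤n/3))
  in Strategy.Play.survives n (k ℕ.∸ 2) r _ λ _ → H , tt , tt
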